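{- Let $G$ be a graph with diameter $2$ and $\chi(G)\geq 4$. Suppose that either $e(\Delta^2(G)-\Delta(G)+1)\leq 2^{\delta(G)}$, or $G$ is $k$-regular for some $k\geq 4$. Then $\chi_2(G)-\chi(G)\leq 1$.
   Context: Graphs are finite and simple. $\chi(G)$ denotes the chromatic number of $G$; $\Delta(G)$ and $\delta(G)$ denote the maximum and minimum degree of $G$, and $\Delta^2(G)=(\Delta(G))^2$; $e$ is the base of the natural logarithm. A dynamic $l$-coloring of $G$ is a proper vertex coloring of $G$ with colors in $\{1,\ldots,l\}$ such that for every vertex $v$ of degree at least $2$, at least two different colors appear on the neighbors of $v$. The dynamic chromatic number $\chi_2(G)$ is the smallest integer $l$ such that $G$ has a dynamic $l$-coloring. -}

module Defs where

open import Data.Fin.Base using (Fin; finToFun; funToFin)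
import Data.Fin.Properties as Fin
open import Data.Integer.Base using (+_)
open import Data.List.Base using (List; []; _∷_; allFin; filter; length; map)
open import Data.List.Extrema.Nat using (max; min)
open import Data.List.Relation.Unary.All as All using (All; _∷_)
open import Data.List.Relation.Unary.All.Properties using (all-filter)
open import Data.List.Relation.Unary.AllPairs using (_∷_)
open import Data.List.Relation.Unary.Unique.Propositional using (Unique)
open import Data.List.Relation.Unary.Unique.Propositional.Properties
  using (allFin⁺; filter⁺)
open import Data.Nat.Base using (ℕ; zero; suc; _≤_; _≥_; z≤n; s≤s; _!)
open import Data.Nat.Properties using (_≤?_; _!≢0)
open import Data.Product.Base using (∃; ∃₂; _×_; _,_; proj₁)
open import Data.Rational.Unnormalised.Base as ℚᵘ using (ℚᵘ; 0ℚᵘ)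
open import Function.Base using (_∘_; id)
open import Relation.Binary.Definitions using (Symmetric; Irreflexive)
  renaming (Decidable to Decidable₂)
open import Relation.Binary.PropositionalEquality
open import Relation.Nullary using (¬_; Dec; yes; no; contradiction)
open import Relation.Nullary.Decidable using (map′; _×-dec_; _→-dec_; ¬?)
open import Relation.Unary using (Decidable)

record Graph (n : ℕ) : Set₁ where
  field
    Adj    : Fin n → Fin n → Set
    adj?   : Decidable₂ Adj
    symm   : Symmetric Adj
    irrefl : Irreflexive _≡_ Adj

module _ {n : ℕ} (G : Graph n) where
  open Graph G

  neighbours : Fin n → List (Fin n)
  neighbours v = filter (adj? v) (allFin n)

  degree : Fin n → ℕ
  degree v = length (neighbours v)

  degrees : List ℕ
  degrees = map degree (allFin n)

  Δ : ℕ
  Δ = max 0 degrees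

  -- The first argument of min is included in the minimum; Δ never lowers it.
  δ : ℕ
  δ = min Δ degrees

  Regular : ℕ → Set
  Regular k = ∀ v → degree v ≡ k

  data Walk : Fin n → Fin n → ℕ → Set where
    nil  : ∀ {v} → Walk v v 0
    cons : ∀ {u v w k} → Adj u v → Walk v w k → Walk u w (suc k)

  Distance : Fin n → Fin n → ℕ → Set
  Distance u v d = Walk u v d × (∀ k → Walk u v k → d ≤ k)

  -- The diameter is the maximum distance; in particular G is connected.
  Diameter : ℕ → Set
  Diameter d = (∀ u v → ∃ λ k → Distance u v k × k ≤ d)
             × (∃₂ λ u v → Distance u v d)

  Proper : ∀ {l} → (Fin n → Fin l) → Set
  Proper c = ∀ u v → Adj u v → c u ≢ c v

  Dynamic : ∀ {l} → (Fin n → Fin l) → Set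
  Dynamic c = Proper c
            × (∀ v → degree v ≥ 2 →
                 ∃₂ λ u w → Adj v u × Adj v w × c u ≢ c w)

  Colorable : ℕ → Set
  Colorable l = ∃ λ (c : Fin n → Fin l) → Proper c

  DynamicColorable : ℕ → Set
  DynamicColorable l = ∃ λ (c : Fin n → Fin l) → Dynamic c

IsLeast : (ℕ → Set) → ℕ → Set
IsLeast P m = P m × (∀ k → P k → m ≤ k)

least : {P : ℕ → Set} → Decidable P → ∀ n → P n → ∃ (IsLeast P)
least P? zero p = 0 , p , λ _ _ → z≤n
least {P} P? (suc n) p with P? 0
... | yes p₀ = 0 , p₀ , λ _ _ → z≤n
... | no ¬p₀ with least {P ∘ suc} (P? ∘ suc) n p
...   | m , pm , lb = suc m , pm , λ where
          zero    p₀ → contradiction p₀ ¬p₀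
          (suc k) pk → s≤s (lb k pk)

-- Function spaces Fin n → Fin l are searched through their encoding in
-- Fin (l ^ n), which is faithful only up to pointwise equality.
any-function? : ∀ {n l} {P : (Fin n → Fin l) → Set} →
                (∀ {f g} → f ≗ g → P f → P g) →
                (∀ f → Dec (P f)) → Dec (∃ P)
any-function? resp P? = map′
  (λ (i , p) → finToFun i , p)
  (λ (f , p) → funToFin f , resp (sym ∘ Fin.finToFun-funToFin f) p)
  (Fin.any? (P? ∘ finToFun))

module _ {n : ℕ} (G : Graph n) where
  open Graph G

  proper? : ∀ {l} (c : Fin n → Fin l) → Dec (Proper G c)
  proper? c = Fin.all? λ u → Fin.all? λ v →
    adj? u v →-dec ¬? (c u Fin.≟ c v)

  dynamic? : ∀ {l} (c : Fin n → Fin l) → Dec (Dynamic G c)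
  dynamic? c = proper? c ×-dec Fin.all? λ v →
    (2 ≤? degree G v) →-dec
      Fin.any? λ u → Fin.any? λ w →
        adj? v u ×-dec adj? v w ×-dec ¬? (c u Fin.≟ c w)

  ≢-resp : ∀ {l} {c d : Fin n → Fin l} → c ≗ d →
           ∀ {u v} → c u ≢ c v → d u ≢ d v
  ≢-resp c≗d {u} {v} ne eq = ne (trans (c≗d u) (trans eq (sym (c≗d v))))

  proper-resp : ∀ {l} {c d : Fin n → Fin l} → c ≗ d → Proper G c → Proper G d
  proper-resp c≗d p u v a = ≢-resp c≗d (p u v a)

  dynamic-resp : ∀ {l} {c d : Fin n → Fin l} → c ≗ d → Dynamic G c → Dynamic G d
  dynamic-resp c≗d (p , q) = proper-resp c≗d p , λ v deg≥2 →
    let u , w , a , b , ne = q v deg≥2 in u , w , a , b , ≢-resp c≗d ne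

  colorable? : Decidable (Colorable G)
  colorable? l = any-function? proper-resp proper?

  dynamicColorable? : Decidable (DynamicColorable G)
  dynamicColorable? l = any-function? dynamic-resp dynamic?

  id-proper : Proper G id
  id-proper u v a eq = irrefl eq a

  id-dynamic : Dynamic G id
  id-dynamic = id-proper , λ v → go
    (all-filter (adj? v) (allFin n)) (filter⁺ (adj? v) (allFin⁺ n))
    where
    go : ∀ {v xs} → All (Adj v) xs → Unique xs → length xs ≥ 2 →
         ∃₂ λ u w → Adj v u × Adj v w × u ≢ w
    go (a ∷ b ∷ _) ((ne ∷ _) ∷ _) _ = _ , _ , a , b , ne
    go (_ ∷ All.[]) _ (s≤s ())

  chromatic : ∃ (IsLeast (Colorable G))
  chromatic = least colorable? n (id , id-proper)

  dynamicChromatic : ∃ (IsLeast (DynamicColorable G))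
  dynamicChromatic = least dynamicColorable? n (id , id-dynamic)

  χ : ℕ
  χ = proj₁ chromatic

  χ₂ : ℕ
  χ₂ = proj₁ dynamicChromatic

-- e-sum k = 1/0! + 1/1! + ⋯ + 1/k!
e-sum : ℕ → ℚᵘ
e-sum zero    = ((+ 1) ℚᵘ./ (0 !)) {{0 !≢0}}
e-sum (suc k) = e-sum k ℚᵘ.+ ((+ 1) ℚᵘ./ (suc k !)) {{suc k !≢0}}

-- e is the supremum of the increasing sequence e-sum, so for natural numbers
-- a and b the real inequality e · a ≤ b says that b bounds every e-sum k · a.
e·_≤_ : ℕ → ℕ → Set
e· a ≤ b = ∀ k → e-sum k ℚᵘ.* ((+ a) ℚᵘ./ 1) ℚᵘ.≤ ((+ b) ℚᵘ./ 1)

{-# OPTIONS --safe #-}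
module Submission where

-- Only two consequences of the hypotheses on the degrees and on χ matter:
-- every vertex has at least three neighbours, and there are at least three
-- colours.  Either alternative gives the first: if δ ≤ 2, then e > 5/2 makes
-- e (Δ² - Δ + 1) larger than 2 ^ δ.
--
-- Fix a proper colouring c with m ≥ 3 colours, and call a vertex monochromatic
-- if its neighbours all have the same colour.  Since G has diameter 2, the
-- neighbourhood of a monochromatic vertex is a whole colour class
-- (mono-neighbourhood), and two monochromatic vertices with different classes
-- as neighbourhoods, having no common neighbour, are adjacent (mono-adjacent).
-- Hence at most two colour classes are neighbourhoods of monochromatic
-- vertices: with a third class, a vertex of that kind would be adjacent to
-- vertices of the first two kinds, which have different colours because they
-- are adjacent to each other (mono-hit).
--
-- One extra colour then suffices (recolour-dynamic):
--  * If there is at most one such class, give the extra colour to one vertex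
--    of it, or to any vertex if there is none.
--  * If there are two such classes with a non-adjacent pair of vertices, one in
--    each, give the extra colour to both vertices of the pair.
--  * If there are two such classes, completely joined to each other, let u and
--    v be monochromatic vertices of the two kinds.  They lie in the two classes.
--    Give u the extra colour and v a colour that differs from those of the two
--    classes.
-- No vertex is monochromatic afterwards.

open import Defs
open import Data.Fin.Base using (Fin; zero; suc)
open import Data.Fin.Properties using (_≟_; any?; suc-injective)
open import Data.Integer.Base as ℤ using (+_)
open import Data.Integer.Properties using (pos-*; drop‿+≤+)
open import Data.List.Base using ([]; _∷_; allFin; length)
open import Data.List.Extrema.Nat using (min≤xs; min≤⊤)
open import Data.List.Membership.Propositional.Properties using (∈-allFin; ∈-map⁺)
open import Data.List.Relation.Unary.All as All using (All; _∷_)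
open import Data.List.Relation.Unary.All.Properties using (all-filter)
open import Data.List.Relation.Unary.AllPairs using (_∷_)
open import Data.List.Relation.Unary.Unique.Propositional using (Unique)
open import Data.List.Relation.Unary.Unique.Propositional.Properties
  using (allFin⁺; filter⁺)
open import Data.Nat using (ℕ; zero; suc; _+_; _*_; _∸_; _^_; _≤_; _≥_; z≤n; s≤s)
open import Data.Nat.Properties
  using (≤-trans; ≤-refl; *-monoʳ-≤; +-mono-≤; +-comm; m≤m+n; m≤n+m; n≤1+n;
         m+n∸m≡n; m≤n+o⇒m∸n≤o; *-identityʳ; module ≤-Reasoning)
open import Data.Product using (∃; ∃₂; _×_; _,_; proj₁; proj₂)
open import Data.Rational.Unnormalised.Base using (*≤*)
open import Data.Sum using (_⊎_; inj₁; inj₂)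
open import Relation.Binary.PropositionalEquality
open import Relation.Nullary using (¬_; Dec; yes; no; contradiction)
open import Relation.Nullary.Decidable using (_×-dec_; ¬?; decidable-stable)

-- Numerical bounds

-- The partial sum 1 + 1 + 1/2 bounds e below by 5/2.
e·≤⇒5*≤2* : ∀ {a b} → e· a ≤ b → 5 * a ≤ b * 2
e·≤⇒5*≤2* {a} {b} h with h 2
... | *≤* p = drop‿+≤+ (subst₂ ℤ._≤_ lhs (sym (pos-* b 2)) p)
  where
  lhs : (+ 5 ℤ.* + a) ℤ.* + 1 ≡ + (5 * a)
  lhs = trans (cong (ℤ._* + 1) (sym (pos-* 5 a)))
          (trans (sym (pos-* (5 * a) 1)) (cong +_ (*-identityʳ (5 * a))))

2≤m⇒2≤m²∸m : ∀ {m} → 2 ≤ m → 2 ≤ m ^ 2 ∸ m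
2≤m⇒2≤m²∸m {suc zero} (s≤s ())
2≤m⇒2≤m²∸m {suc (suc k)} _ = begin
  2                            ≤⟨ m≤m+n 2 k ⟩
  m                            ≤⟨ m≤m+n m (k * m) ⟩
  suc k * m                    ≡⟨ m+n∸m≡n m (suc k * m) ⟨
  m * m ∸ m                    ≡⟨ cong (λ t → m * t ∸ m) (*-identityʳ m) ⟨
  m ^ 2 ∸ m                    ∎
  where
  open ≤-Reasoning
  m = suc (suc k)

e-bound⇒3≤ : ∀ {D d} → d ≤ D → e· (D ^ 2 ∸ D + 1) ≤ (2 ^ d) → 3 ≤ d
e-bound⇒3≤ {D} {d} d≤D h = go d d≤D (e·≤⇒5*≤2* h)
  where
  go : ∀ d → d ≤ D → 5 * (D ^ 2 ∸ D + 1) ≤ 2 ^ d * 2 → 3 ≤ d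
  go 0 _ p = contradiction
    (≤-trans (*-monoʳ-≤ 5 (m≤n+m 1 (D ^ 2 ∸ D))) p) λ { (s≤s (s≤s ())) }
  go 1 _ p = contradiction
    (≤-trans (*-monoʳ-≤ 5 (m≤n+m 1 (D ^ 2 ∸ D))) p) λ { (s≤s (s≤s (s≤s (s≤s ())))) }
  go 2 2≤D p = contradiction
    (≤-trans (*-monoʳ-≤ 5 (+-mono-≤ (2≤m⇒2≤m²∸m 2≤D) (≤-refl {1}))) p)
    λ { (s≤s (s≤s (s≤s (s≤s (s≤s (s≤s (s≤s (s≤s ())))))))) }
  go (suc (suc (suc _))) _ _ = s≤s (s≤s (s≤s z≤n))

third-colour : ∀ {m} → 3 ≤ m → (i j : Fin m) → ∃ λ k → k ≢ i × k ≢ j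
third-colour (s≤s (s≤s (s≤s _))) zero          zero          = suc zero , (λ ()) , λ ()
third-colour (s≤s (s≤s (s≤s _))) zero          (suc zero)    = suc (suc zero) , (λ ()) , λ ()
third-colour (s≤s (s≤s (s≤s _))) zero          (suc (suc _)) = suc zero , (λ ()) , λ ()
third-colour (s≤s (s≤s (s≤s _))) (suc zero)    zero          = suc (suc zero) , (λ ()) , λ ()
third-colour (s≤s (s≤s (s≤s _))) (suc (suc _)) zero          = suc zero , (λ ()) , λ ()
third-colour (s≤s (s≤s (s≤s _))) (suc _)       (suc _)       = zero , (λ ()) , λ ()

module _ {n : ℕ} (G : Graph n) where
  open Graph G

  -- Degrees and distances

  δ≤degree : ∀ v → δ G ≤ degree G v
  δ≤degree v = All.lookup (min≤xs (Δ G) (degrees G)) (∈-map⁺ (degree G) (∈-allFin v))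

  δ≤Δ : δ G ≤ Δ G
  δ≤Δ = min≤⊤ (Δ G) (degrees G)

  3≤degree : (e· (Δ G ^ 2 ∸ Δ G + 1) ≤ (2 ^ δ G)) ⊎ (∃ λ k → k ≥ 4 × Regular G k) →
             ∀ v → 3 ≤ degree G v
  3≤degree (inj₁ bound) v           = ≤-trans (e-bound⇒3≤ δ≤Δ bound) (δ≤degree v)
  3≤degree (inj₂ (k , 4≤k , reg)) v = subst (3 ≤_) (sym (reg v)) (≤-trans (n≤1+n 3) 4≤k)

  -- Every vertex has a neighbour other than two given vertices.
  ThirdNeighbour : Set
  ThirdNeighbour = ∀ v a b → ∃ λ z → Adj v z × z ≢ a × z ≢ b

  3≤degree⇒thirdNeighbour : (∀ v → 3 ≤ degree G v) → ThirdNeighbour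
  3≤degree⇒thirdNeighbour 3≤deg v a b = go
    (all-filter (adj? v) (allFin n)) (filter⁺ (adj? v) (allFin⁺ n)) (3≤deg v)
    where
    go : ∀ {xs} → All (Adj v) xs → Unique xs → 3 ≤ length xs →
         ∃ λ z → Adj v z × z ≢ a × z ≢ b
    go {p ∷ q ∷ r ∷ _} (vp ∷ vq ∷ vr ∷ _) ((p≢q ∷ p≢r ∷ _) ∷ (q≢r ∷ _) ∷ _) _
      with p ≟ a | p ≟ b | q ≟ a | q ≟ b
    ... | no p≢a  | no p≢b   | _        | _        = p , vp , p≢a , p≢b
    ... | _       | _        | no q≢a   | no q≢b   = q , vq , q≢a , q≢b
    ... | yes refl | _       | yes refl | _        = contradiction refl p≢q
    ... | _       | yes refl | _        | yes refl = contradiction refl p≢q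
    ... | yes refl | no _    | no _     | yes refl = r , vr , ≢-sym p≢r , ≢-sym q≢r
    ... | no _ | yes refl    | yes refl | no _     = r , vr , ≢-sym q≢r , ≢-sym p≢r
    go {_ ∷ []}     _ _ (s≤s ())
    go {_ ∷ _ ∷ []} _ _ (s≤s (s≤s ()))

  -- Any two vertices are at distance at most 2.
  WithinTwo : Set
  WithinTwo = ∀ u v → u ≡ v ⊎ Adj u v ⊎ ∃ λ t → Adj u t × Adj v t

  diameter2⇒withinTwo : Diameter G 2 → WithinTwo
  diameter2⇒withinTwo (near , _) u v with near u v
  ... | _ , (nil , _) , _ = inj₁ refl
  ... | _ , (cons a nil , _) , _ = inj₂ (inj₁ a)
  ... | _ , (cons a (cons b nil) , _) , _ = inj₂ (inj₂ (_ , a , symm b))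
  ... | _ , (cons _ (cons _ (cons _ _)) , _) , s≤s (s≤s ())

  -- Monochromatic vertices

  -- The neighbours of v all have the same colour under c.
  Mono : ∀ {l} → (Fin n → Fin l) → Fin n → Set
  Mono c v = ∀ {x y} → Adj v x → Adj v y → c x ≡ c y

  two-colours? : ∀ {l} (c : Fin n → Fin l) v →
                 Dec (∃₂ λ x y → Adj v x × Adj v y × c x ≢ c y)
  two-colours? c v = any? λ x → any? λ y →
    adj? v x ×-dec adj? v y ×-dec ¬? (c x ≟ c y)

  ¬two-colours⇒mono : ∀ {l} {c : Fin n → Fin l} {v} →
    ¬ (∃₂ λ x y → Adj v x × Adj v y × c x ≢ c y) → Mono c v
  ¬two-colours⇒mono {c = c} none {x} {y} vx vy =
    decidable-stable (c x ≟ c y) λ ne → none (x , y , vx , vy , ne)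

  mono? : ∀ {l} (c : Fin n → Fin l) v → Dec (Mono c v)
  mono? c v with two-colours? c v
  ... | yes (_ , _ , vx , vy , ne) = no λ mono → ne (mono vx vy)
  ... | no none                    = yes (¬two-colours⇒mono none)

  no-mono⇒dynamic : ∀ {l} {c : Fin n → Fin l} → Proper G c →
                    (∀ v → ¬ Mono c v) → Dynamic G c
  no-mono⇒dynamic {c = c} proper none = proper , λ v _ →
    decidable-stable (two-colours? c v) λ ¬two → none v (¬two-colours⇒mono ¬two)

  -- Recolouring two vertices

  -- The colouring with one more colour, zero, that gives this colour to x and
  -- the colour e to y, and agrees with c elsewhere; if x and y are equal, they
  -- have the colour zero.  An old colour k becomes suc k.
  recolour : ∀ {m} → (Fin n → Fin m) → Fin n → Fin n → Fin (suc m) →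
             Fin n → Fin (suc m)
  recolour c x y e z with z ≟ x | z ≟ y
  ... | yes _ | _     = zero
  ... | no _  | yes _ = e
  ... | no _  | no _  = suc (c z)

  module _ {m} (c : Fin n → Fin m) (x y : Fin n) (e : Fin (suc m)) where

    recolour-x : recolour c x y e x ≡ zero
    recolour-x with x ≟ x
    ... | yes _  = refl
    ... | no x≢x = contradiction refl x≢x

    recolour-y : y ≢ x → recolour c x y e y ≡ e
    recolour-y y≢x with y ≟ x | y ≟ y
    ... | yes y≡x | _      = contradiction y≡x y≢x
    ... | no _    | yes _  = refl
    ... | no _    | no y≢y = contradiction refl y≢y

    recolour-other : ∀ {z} → z ≢ x → z ≢ y → recolour c x y e z ≡ suc (c z)
    recolour-other {z} z≢x z≢y with z ≟ x | z ≟ y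
    ... | yes z≡x | _       = contradiction z≡x z≢x
    ... | no _    | yes z≡y = contradiction z≡y z≢y
    ... | no _    | no _    = refl

  -- By xy and free, e is a legitimate colour for y.  A vertex w is not
  -- monochromatic afterwards: if x is a neighbour of w, then another one has an
  -- old colour; if y is, then wit gives another one whose colour is not e; and
  -- if neither is, then w was not monochromatic before, by hit, and its
  -- neighbours keep their colours.
  module _ (third : ThirdNeighbour)
           {m} {c : Fin n → Fin m} (proper : Proper G c)
           {x y : Fin n} {e : Fin (suc m)}
           (hit  : ∀ {w} → Mono c w → Adj w x ⊎ Adj w y)
           (xy   : Adj x y → e ≢ zero)
           (free : ∀ {z} → Adj y z → e ≢ suc (c z))
           (wit  : ∀ {w} → Adj w y → ∃ λ z → Adj w z × z ≢ x × z ≢ y × e ≢ suc (c z))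
           where

    private
      c′ : Fin n → Fin (suc m)
      c′ = recolour c x y e

    recolour-proper : Proper G c′
    recolour-proper u v uv with u ≟ x | u ≟ y | v ≟ x | v ≟ y
    ... | yes refl | _        | yes refl | _        = contradiction uv (irrefl refl)
    ... | yes refl | _        | no _     | yes refl = ≢-sym (xy uv)
    ... | yes refl | _        | no _     | no _     = λ ()
    ... | no _     | yes refl | yes refl | _        = xy (symm uv)
    ... | no _     | no _     | yes refl | _        = λ ()
    ... | no _     | yes refl | no _     | yes refl = contradiction uv (irrefl refl)
    ... | no _     | yes refl | no _     | no _     = free uv
    ... | no _     | no _     | no _     | yes refl = ≢-sym (free (symm uv))
    ... | no _     | no _     | no _     | no _     =
      λ eq → proper u v uv (suc-injective eq)

    recolour-¬mono : ∀ w → ¬ Mono c′ w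
    recolour-¬mono w mono with adj? w x
    ... | yes wx =
      let z , wz , z≢x , z≢y = third w x y
      in contradiction
        (trans (sym (recolour-x c x y e))
          (trans (mono wx wz) (recolour-other c x y e z≢x z≢y)))
        λ ()
    ... | no ¬wx with adj? w y
    ...   | yes wy =
      let z , wz , z≢x , z≢y , e≢z = wit wy
      in e≢z (trans (sym (recolour-y c x y e λ { refl → ¬wx wy }))
               (trans (mono wy wz) (recolour-other c x y e z≢x z≢y)))
    ...   | no ¬wy with hit (λ wa wb → suc-injective
                       (trans (sym (old wa)) (trans (mono wa wb) (old wb))))
      where
      old : ∀ {z} → Adj w z → c′ z ≡ suc (c z)
      old wz = recolour-other c x y e
        (λ { refl → ¬wx wz }) (λ { refl → ¬wy wz })
    ...     | inj₁ wx = ¬wx wx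
    ...     | inj₂ wy = ¬wy wy

    recolour-dynamic : DynamicColorable G (suc m)
    recolour-dynamic = c′ , no-mono⇒dynamic recolour-proper recolour-¬mono

  -- Monochromatic vertices when the diameter is two

  module _ (third : ThirdNeighbour) (within : WithinTwo)
           {m} (c : Fin n → Fin m) (proper : Proper G c)
           where

    -- The extra colour goes to two non-adjacent vertices, possibly equal.  No
    -- neighbourhood lies within these two, as it has at least three vertices.
    split-dynamic : ∀ {x y} → (∀ {w} → Mono c w → Adj w x ⊎ Adj w y) →
                    ¬ Adj x y → DynamicColorable G (suc m)
    split-dynamic {x} {y} hit ¬xy = recolour-dynamic third proper {e = zero} hit
      (λ xy _ → ¬xy xy) (λ _ ())
      (λ {w} _ → let z , wz , z≢x , z≢y = third w x y in z , wz , z≢x , z≢y , λ ())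

    -- The neighbourhood of a monochromatic vertex w is a whole colour class: a
    -- non-neighbour of w in that class would share with w a neighbour, which
    -- has the colour of the class too.
    mono-neighbourhood : ∀ {w x z} → Mono c w → Adj w x → c z ≡ c x → Adj w z
    mono-neighbourhood {w} {x} {z} mono wx cz≡cx with within w z
    ... | inj₁ refl                  = contradiction cz≡cx (proper w x wx)
    ... | inj₂ (inj₁ wz)             = wz
    ... | inj₂ (inj₂ (t , wt , zt)) =
      contradiction (trans cz≡cx (mono wx wt)) (proper z t zt)

    mono-adjacent : ∀ {v w x y} → Mono c v → Mono c w → Adj v x → Adj w y →
                    c x ≢ c y → Adj v w
    mono-adjacent {v} {w} monov monow vx wy x≢y with within v w
    ... | inj₁ refl                  = contradiction (monov vx wy) x≢y
    ... | inj₂ (inj₁ vw)             = vw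
    ... | inj₂ (inj₂ (t , vt , wt)) =
      contradiction (trans (monov vx vt) (monow wt wy)) x≢y

    -- There are at most two colour classes that are neighbourhoods of
    -- monochromatic vertices.
    mono-hit : ∀ {v u x y} → Mono c v → Mono c u → Adj v x → Adj u y →
               c x ≢ c y → ∀ {w} → Mono c w → Adj w x ⊎ Adj w y
    mono-hit {v} {u} {x} {y} monov monou vx uy x≢y {w} monow
      with third w w w
    ... | z , wz , _ with c x ≟ c z | c y ≟ c z
    ...   | yes x≡z | _       = inj₁ (mono-neighbourhood monow wz x≡z)
    ...   | no _    | yes y≡z = inj₂ (mono-neighbourhood monow wz y≡z)
    ...   | no x≢z  | no y≢z  = contradiction
      -- w is adjacent to v and u, so these have the same colour; but they are
      -- adjacent to each other.
      (monow (symm (mono-adjacent monov monow vx wz x≢z))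
             (symm (mono-adjacent monou monow uy wz y≢z)))
      (proper v u (mono-adjacent monov monou vx uy x≢y))

    -- The neighbourhoods of v and u are two classes, joined completely; u lies
    -- in the first and v in the second.  Every neighbour w of v is adjacent to
    -- the whole second class, hence to a vertex of it other than v, which keeps
    -- its colour.
    joined-dynamic : 3 ≤ m → ∀ {v u x y} → Mono c v → Mono c u → Adj v x → Adj u y →
      c x ≢ c y → (∀ {a b} → Adj v a → Adj u b → Adj a b) →
      DynamicColorable G (suc m)
    joined-dynamic 3≤m {v} {u} monov monou vx uy x≢y join =
      let l , l≢u , l≢v = third-colour 3≤m (c u) (c v)
          vu = mono-adjacent monov monou vx uy x≢y
          uv = symm vu
          u≢v = proper u v uv
      in recolour-dynamic third proper {x = u} {y = v} {e = suc l}
           (mono-hit monov monou vu uv u≢v)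
           (λ _ ())
           (λ vz eq → l≢u (trans (suc-injective eq) (monov vz vu)))
           (λ wv →
             let z , uz , z≢u , z≢v = third u u v
             in z , join (symm wv) uz , z≢u , z≢v ,
                λ eq → l≢v (trans (suc-injective eq) (monou uz uv)))

    two-classes-dynamic : 3 ≤ m → ∀ {v u x y} → Mono c v → Mono c u → Adj v x →
      Adj u y → c x ≢ c y → DynamicColorable G (suc m)
    two-classes-dynamic 3≤m {v} {u} monov monou vx uy x≢y
      with any? (λ a → any? λ b → adj? v a ×-dec adj? u b ×-dec ¬? (adj? a b))
    ... | yes (a , b , va , ub , ¬ab) = split-dynamic
      (mono-hit monov monou va ub λ a≡b →
        x≢y (trans (monov vx va) (trans a≡b (monou ub uy))))
      ¬ab
    ... | no none = joined-dynamic 3≤m monov monou vx uy x≢y λ {a} {b} va ub →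
      decidable-stable (adj? a b) λ ¬ab → none (a , b , va , ub , ¬ab)

    one-more-colour : 3 ≤ m → Fin n → DynamicColorable G (suc m)
    one-more-colour 3≤m v₀ with any? (mono? c)
    ... | no none = split-dynamic {v₀} {v₀}
      (λ {w} mono → contradiction (w , λ {_} {_} → mono) none) (irrefl refl)
    ... | yes (v , monov) with third v v v
    ...   | x , vx , _ with any? (λ u → mono? c u ×-dec ¬? (adj? u x))
    ...     | no none = split-dynamic {x} {x}
      (λ {w} mono → inj₁ (decidable-stable (adj? w x) λ ¬wx →
        none (w , (λ {_} {_} → mono) , ¬wx)))
      (irrefl refl)
    ...     | yes (u , monou , ¬ux) with third u u u
    ...       | y , uy , _ = two-classes-dynamic 3≤m monov monou vx uy
      λ x≡y → ¬ux (mono-neighbourhood monou uy x≡y)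

corollary2 : ∀ {n : ℕ} (G : Graph n) →
    Diameter G 2 →
    χ G ≥ 4 →
    (e· (Δ G ^ 2 ∸ Δ G + 1) ≤ (2 ^ δ G)) ⊎ (∃ λ k → k ≥ 4 × Regular G k) →
    χ₂ G ∸ χ G ≤ 1
corollary2 G diam@(_ , v₀ , _) 4≤χ hyp =
  m≤n+o⇒m∸n≤o (χ₂ G) (χ G) (subst (χ₂ G ≤_) (+-comm 1 (χ G)) χ₂≤1+χ)
  where
  χ-colouring : Colorable G (χ G)
  χ-colouring = proj₁ (proj₂ (chromatic G))

  χ₂≤1+χ : χ₂ G ≤ suc (χ G)
  χ₂≤1+χ = proj₂ (proj₂ (dynamicChromatic G)) (suc (χ G))
    (one-more-colour G (3≤degree⇒thirdNeighbour G (3≤degree G hyp))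
      (diameter2⇒withinTwo G diam) (proj₁ χ-colouring) (proj₂ χ-colouring)
      (≤-trans (n≤1+n 3) 4≤χ) v₀)
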